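{- Let $n,\ell,t$ be positive integers such that $t\le \ell-2$, $n\ge 2\ell\log_2 n$ and $n\ge 48$. Let $\mathcal{F}\subset\mathcal{P}_n^\ell$ be $t$-intersecting. Then $|\mathcal{F}|\le \left\{ {n-t \atop \ell-t} \right\}$. Moreover, if $\mathcal{F}$ is not contained in the family of all partitions in $\mathcal{P}_n^\ell$ having $\{x_1\},\ldots,\{x_t\}$ as parts for some distinct $x_1,\ldots,x_t\in[n]$, then $|\mathcal{F}|\le \frac12\left\{ {n-t \atop \ell-t} \right\}$.
   Context: $\mathcal{P}_n^\ell$ denotes the family of all partitions of $[n]=\{1,\ldots,n\}$ into exactly $\ell$ nonempty parts; $\left\{ {m \atop j} \right\}$ denotes the Stirling number of the second kind (the number of partitions of an $m$-element set into $j$ nonempty parts). Two partitions are $t$-intersecting if they share at least $t$ parts; a family is $t$-intersecting if any two of its members are. -}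

module Defs where

open import Data.Nat using (ℕ; zero; suc; _+_; _*_)
open import Data.Bool using (Bool)
import Data.Bool.Properties as BoolP
open import Data.Fin using (Fin)
open import Data.Fin.Subset using (Subset; _∈_; ⁅_⁆)
open import Data.Vec using (Vec; lookup; toList)
import Data.Vec.Properties as VecP
open import Data.List using (List; length; filter; deduplicate)
import Data.List.Membership.DecPropositional as DecMem
open import Relation.Binary.PropositionalEquality using (_≡_)
open import Relation.Binary.Definitions using (DecidableEquality)

S : ℕ → ℕ → ℕ
S zero    zero    = 1
S zero    (suc k) = 0
S (suc n) zero    = 0
S (suc n) (suc k) = suc k * S n (suc k) + S n k

-- A (candidate) partition of [n] = Fin n is encoded by the vector of
-- "parts containing x": row x of the matrix is the part containing x.
-- This encoding is canonical: two partitions are equal iff the matrices are.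
PMat : ℕ → Set
PMat n = Vec (Subset n) n

part : ∀ {n} → PMat n → Fin n → Subset n
part R x = lookup R x

_≟S_ : ∀ {n} → DecidableEquality (Subset n)
_≟S_ = VecP.≡-dec BoolP._≟_

parts : ∀ {n} → PMat n → List (Subset n)
parts R = deduplicate _≟S_ (toList R)

record IsPartition (n ℓ : ℕ) (R : PMat n) : Set where
  field
    self∈part  : ∀ x → x ∈ part R x
    part-coh   : ∀ x y → y ∈ part R x → part R y ≡ part R x
    numParts   : length (parts R) ≡ ℓ

commonParts : ∀ {n} → PMat n → PMat n → ℕ
commonParts {n} P Q = length (filter (λ B → B ∈? parts Q) (parts P))
  where open DecMem (_≟S_ {n})

HasSingletonPart : ∀ {n} → PMat n → Fin n → Set
HasSingletonPart P x = part P x ≡ ⁅ x ⁆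

{-# OPTIONS --safe #-}
module Submission where

-- Call a set X of blocks a t-cover of F if every member of F has at least t of
-- its parts in X; each member of F is itself a t-cover of size ℓ.  Let t + s be
-- the least size of a t-cover.  If s = 0, the t blocks are common to all of F:
-- unless they are all singletons they cover at least t + 1 points, and
-- 2 S(m, j) ≤ S(m + 1, j) for j ≥ 2.  If s ≥ 1, choose t common blocks of the
-- minimal cover (at most ℓ^s ways, deleting one block at a time) and enlarge
-- them to t + s blocks: a smaller set Y is no t-cover, so some G ∈ F meets it in
-- fewer than t blocks and each P ∈ F containing Y contains one of the ℓ parts of
-- G outside Y.  Hence |F| ≤ ℓ^2s S(n - t - s, ℓ - t - s), and the growth
-- 2ℓ² S(m, j) ≤ S(m + 1, j + 1), valid as n^2ℓ ≤ 2^n, gives |F| ≤ S(n - t, ℓ - t) / 2.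
-- When t + s = ℓ the last Stirling number has to be replaced by 1, which is
-- harmless because S(n - t, s) ≥ s^(n - ℓ).

open import Defs
open import Data.Nat using (ℕ; zero; suc; _+_; _*_; _∸_; _^_; _≤_; _<_; z≤n; s≤s; z<s; s≤s⁻¹; _≤?_; _<?_; NonZero; >-nonZero; >-nonZero⁻¹; _!; _≤′_; ≤′-refl; ≤′-step)
open import Data.Nat.Properties hiding (_≟_)
open import Data.Nat.Induction using (<-rec)
open import Data.Nat.Tactic.RingSolver using (solve-∀)
open import Data.Empty using (⊥)
open import Data.Fin using (Fin; _≟_) renaming (zero to fzero; suc to fsuc)
open import Data.Fin.Properties using (injective⇒≤) renaming (any? to anyFin?)
open import Data.Fin.Subset using (Subset; ⁅_⁆) renaming (_∈_ to _∈ₛ_)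
open import Data.Fin.Subset.Properties using (⊆-antisym; x∈⁅x⁆; x∈⁅y⁆⇒x≡y) renaming (_∈?_ to _∈ₛ?_)
open import Data.List using (List; []; _∷_; _++_; length; map; filter; lookup; allFin)
open import Data.List.Properties using (length-map; length-++; filter-notAll; length-tabulate; ++-identityʳ)
open import Data.List.Relation.Unary.All as All using (All; []; _∷_; all?)
open import Data.List.Relation.Unary.All.Properties using (all-filter; ¬All⇒Any¬) renaming (filter⁺ to All-filter⁺)
open import Data.List.Relation.Unary.AllPairs using ([]; _∷_)
open import Data.List.Relation.Unary.Any using (Any; here; there; any?; index)
open import Data.List.Relation.Unary.Any.Properties using (lookup-index)
open import Data.List.Relation.Unary.Unique.Propositional using (Unique)
open import Data.List.Relation.Unary.Unique.Propositional.Properties using (allFin⁺; filter⁺; map⁺; map⁻) renaming (++⁺ to Unique-++⁺)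
import Data.List.Relation.Unary.Unique.DecPropositional.Properties as DecUnique
open import Data.List.Membership.Propositional using (_∈_; _∉_; find; lose)
open import Data.List.Membership.Propositional.Properties using (∈-lookup; ∈-map⁺; ∈-map⁻; ∈-++⁺ˡ; ∈-++⁺ʳ; ∈-++⁻; ∈-filter⁺; ∈-filter⁻; ∈-allFin; ∈-deduplicate⁺; ∈-deduplicate⁻)
import Data.List.Membership.DecPropositional as DecMem
import Data.Vec as Vec
open import Data.Vec.Properties using (tabulate∘lookup; tabulate-cong)
open import Data.Vec.Membership.Propositional.Properties using (∈-toList⁺; ∈-toList⁻) renaming (∈-lookup to ∈ᵥ-lookup)
import Data.Vec.Relation.Unary.Any as VecAny
import Data.Vec.Relation.Unary.Any.Properties as VecAny
open import Data.Product using (Σ; ∃; _×_; _,_; proj₁; proj₂)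
open import Data.Sum using (_⊎_; inj₁; inj₂)
open import Function using (_∘_; case_of_)
open import Function.Definitions using (Injective)
open import Relation.Binary.PropositionalEquality
open import Relation.Nullary using (¬_; Dec; yes; no; contradiction; ¬?)
open import Relation.Nullary.Decidable using (_×-dec_; decidable-stable)
open import Relation.Unary using (Decidable)

-- Growth of the Stirling numbers

-- The number of ways to distribute m further points when i blocks are already
-- open and exactly e more have to be opened.  Recursing on the first point
-- instead of the last keeps j! S(m, j) ≤ j^m inductive.
extensions : ℕ → ℕ → ℕ → ℕ
extensions zero    i zero    = 1
extensions zero    i (suc e) = 0
extensions (suc m) i zero    = i * extensions m i zero
extensions (suc m) i (suc e) = i * extensions m i (suc e) + extensions m (suc i) e

-- Conditioning on the last point instead of the first: it joins one of the `i + suc e` blocks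
-- present at the end, or it is the point that opens the final block. At `i = 0` this is the
-- recursion defining `S`.
extensions-last : ∀ m i e →
  extensions (suc m) i (suc e) ≡ (i + suc e) * extensions m i (suc e) + extensions m i e
extensions-last zero i zero = lemma i
  where
  lemma : ∀ i → i * 0 + 1 ≡ (i + 1) * 0 + 1
  lemma = solve-∀
extensions-last zero i (suc e) = lemma i e
  where
  lemma : ∀ i e → i * 0 + 0 ≡ (i + (2 + e)) * 0 + 0
  lemma = solve-∀
extensions-last (suc m) i zero = begin
    i * extensions (suc m) i 1 + suc i * a
  ≡⟨ cong (λ z → i * z + suc i * a) (extensions-last m i 0) ⟩
    i * ((i + 1) * extensions m i 1 + extensions m i 0) + suc i * a
  ≡⟨ lemma i (extensions m i 1) (extensions m i 0) a ⟩
    (i + 1) * (i * extensions m i 1 + a) + i * extensions m i 0 ∎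
  where
  open ≡-Reasoning
  a = extensions m (suc i) 0
  lemma : ∀ i x y a → i * ((i + 1) * x + y) + suc i * a ≡ (i + 1) * (i * x + a) + i * y
  lemma = solve-∀
extensions-last (suc m) i (suc e) = begin
    i * extensions (suc m) i (2 + e) + extensions (suc m) (suc i) (suc e)
  ≡⟨ cong₂ (λ z w → i * z + w) (extensions-last m i (suc e)) (extensions-last m (suc i) e) ⟩
    i * ((i + (2 + e)) * x + y) + ((suc i + suc e) * z + w)
  ≡⟨ lemma i e x y z w ⟩
    (i + (2 + e)) * (i * x + z) + (i * y + w) ∎
  where
  open ≡-Reasoning
  x = extensions m i (2 + e)
  y = extensions m i (suc e)
  z = extensions m (suc i) (suc e)
  w = extensions m (suc i) e
  lemma : ∀ i e x y z w → i * ((i + (2 + e)) * x + y) + ((suc i + suc e) * z + w)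
    ≡ (i + (2 + e)) * (i * x + z) + (i * y + w)
  lemma = solve-∀

S≡extensions : ∀ m e → S m e ≡ extensions m 0 e
S≡extensions zero zero = refl
S≡extensions zero (suc e) = refl
S≡extensions (suc m) zero = refl
S≡extensions (suc m) (suc e) = begin
    suc e * S m (suc e) + S m e
  ≡⟨ cong₂ (λ a b → suc e * a + b) (S≡extensions m (suc e)) (S≡extensions m e) ⟩
    suc e * extensions m 0 (suc e) + extensions m 0 e
  ≡⟨ extensions-last m 0 e ⟨
    extensions (suc m) 0 (suc e) ∎
  where open ≡-Reasoning

-- e! extensions m i e counts the maps from m points to i + e labels hitting the
-- last e labels; the lower bound discards, for each of these, the maps missing it.
extensions-upper : ∀ m i e → e ! * extensions m i e ≤ (i + e) ^ m
extensions-upper zero i zero = ≤-refl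
extensions-upper zero i (suc e) = ≤-trans (≤-reflexive (*-zeroʳ (suc e !))) z≤n
extensions-upper (suc m) i zero = begin
    1 * (i * extensions m i 0)   ≡⟨ lemma i (extensions m i 0) ⟩
    (i + 0) * (1 * extensions m i 0) ≤⟨ *-monoʳ-≤ (i + 0) (extensions-upper m i 0) ⟩
    (i + 0) * (i + 0) ^ m ∎
  where
  open ≤-Reasoning
  lemma : ∀ i x → 1 * (i * x) ≡ (i + 0) * (1 * x)
  lemma = solve-∀
extensions-upper (suc m) i (suc e) = begin
    suc e ! * (i * x + y)                        ≡⟨ lemma i e (e !) x y ⟩
    i * (suc e ! * x) + suc e * (e ! * y)        ≤⟨ +-mono-≤ (*-monoʳ-≤ i (extensions-upper m i (suc e)))
                                                             (*-monoʳ-≤ (suc e) (extensions-upper m (suc i) e)) ⟩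
    i * (i + suc e) ^ m + suc e * (suc i + e) ^ m ≡⟨ cong (λ z → i * (i + suc e) ^ m + suc e * z ^ m) (sym (+-suc i e)) ⟩
    i * (i + suc e) ^ m + suc e * (i + suc e) ^ m ≡⟨ *-distribʳ-+ ((i + suc e) ^ m) i (suc e) ⟨
    (i + suc e) ^ suc m ∎
  where
  open ≤-Reasoning
  x = extensions m i (suc e)
  y = extensions m (suc i) e
  lemma : ∀ i e f x y → (suc e * f) * (i * x + y) ≡ i * ((suc e * f) * x) + suc e * (f * y)
  lemma = solve-∀

extensions-lower : ∀ m i e →
  (i + e) ^ m ≤ e ! * extensions m i e + e * (i + e ∸ 1) ^ m
extensions-lower zero i zero = s≤s z≤n
extensions-lower zero i (suc e) = ≤-trans (s≤s z≤n) (m≤n+m (suc e * 1) (suc e ! * 0))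
extensions-lower (suc m) i zero = begin
    (i + 0) * (i + 0) ^ m              ≤⟨ *-monoʳ-≤ (i + 0) (extensions-lower m i 0) ⟩
    (i + 0) * (1 * extensions m i 0 + 0) ≡⟨ lemma i (extensions m i 0) ⟩
    1 * (i * extensions m i 0) + 0 ∎
  where
  open ≤-Reasoning
  lemma : ∀ i x → (i + 0) * (1 * x + 0) ≡ 1 * (i * x) + 0
  lemma = solve-∀
extensions-lower (suc m) i (suc e) rewrite +-suc i e = begin
    suc (i + e) * p                                      ≡⟨ lemma₁ i e p ⟩
    i * p + suc e * p                                    ≤⟨ +-mono-≤ (*-monoʳ-≤ i ih₁) (*-monoʳ-≤ (suc e) ih₂) ⟩
    i * (suc e ! * x + suc e * q) + suc e * (e ! * y + e * q) ≡⟨ lemma₂ i e (e !) x y q ⟩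
    suc e ! * (i * x + y) + suc e * ((i + e) * q) ∎
  where
  open ≤-Reasoning
  p = suc (i + e) ^ m
  q = (i + e) ^ m
  x = extensions m i (suc e)
  y = extensions m (suc i) e
  ih₁ : p ≤ suc e ! * x + suc e * q
  ih₁ = subst (λ z → z ^ m ≤ suc e ! * x + suc e * (z ∸ 1) ^ m) (+-suc i e) (extensions-lower m i (suc e))
  ih₂ : p ≤ e ! * y + e * q
  ih₂ = extensions-lower m (suc i) e
  lemma₁ : ∀ i e p → suc (i + e) * p ≡ i * p + suc e * p
  lemma₁ = solve-∀
  lemma₂ : ∀ i e f x y q → i * ((suc e * f) * x + suc e * q) + suc e * (f * y + e * q)
    ≡ (suc e * f) * (i * x + y) + suc e * ((i + e) * q)
  lemma₂ = solve-∀

S-upper : ∀ m j → j ! * S m j ≤ j ^ m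
S-upper m j rewrite S≡extensions m j = extensions-upper m 0 j

S-lower : ∀ m j → suc j ^ m ≤ suc j ! * S m (suc j) + suc j * j ^ m
S-lower m j rewrite S≡extensions m (suc j) = extensions-lower m 0 (suc j)

-- Keeps only the term `suc j * S m (suc j)` of the recursion and compares it with `S m j` through
-- `S-upper` and `S-lower`. The summand `suc j` beside `K` pays for the maps discarded in `S-lower`.
S-ratio : ∀ K m j → (K + suc j) * j ^ m ≤ suc j ^ m → K * S m j ≤ S (suc m) (suc j)
S-ratio K m j hyp = ≤-trans (*-cancelˡ-≤ (j !) {{j !≢0}} scaled) (m≤m+n _ (S m j))
  where
  open ≤-Reasoning
  lemma₁ : ∀ f K s → f * (K * s) ≡ K * (f * s)
  lemma₁ = solve-∀
  lemma₂ : ∀ j f s → (suc j * f) * s ≡ f * (suc j * s)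
  lemma₂ = solve-∀
  scaled : j ! * (K * S m j) ≤ j ! * (suc j * S m (suc j))
  scaled = +-cancelʳ-≤ (suc j * j ^ m) _ _ (begin
    j ! * (K * S m j) + suc j * j ^ m ≡⟨ cong (_+ suc j * j ^ m) (lemma₁ (j !) K (S m j)) ⟩
    K * (j ! * S m j) + suc j * j ^ m ≤⟨ +-monoˡ-≤ _ (*-monoʳ-≤ K (S-upper m j)) ⟩
    K * j ^ m + suc j * j ^ m         ≡⟨ *-distribʳ-+ (j ^ m) K (suc j) ⟨
    (K + suc j) * j ^ m               ≤⟨ hyp ⟩
    suc j ^ m                         ≤⟨ S-lower m j ⟩
    suc j ! * S m (suc j) + suc j * j ^ m ≡⟨ cong (_+ suc j * j ^ m) (lemma₂ j (j !) (S m (suc j))) ⟩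
    j ! * (suc j * S m (suc j)) + suc j * j ^ m ∎)

-- Power inequalities and growth along diagonals

^-cancelˡ-≤ : ∀ j {a b} → .{{_ : NonZero j}} → a ^ j ≤ b ^ j → a ≤ b
^-cancelˡ-≤ j {a} {b} le with a ≤? b
... | yes a≤b = a≤b
... | no a≰b = contradiction le (<⇒≱ (^-monoˡ-< j (≰⇒> a≰b)))

^-comm-exp : ∀ a m j → (a ^ m) ^ j ≡ (a ^ j) ^ m
^-comm-exp a m j = trans (^-*-assoc a m j) (trans (cong (a ^_) (*-comm m j)) (sym (^-*-assoc a j m)))

^-distribʳ-* : ∀ o m n → (m * n) ^ o ≡ m ^ o * n ^ o
^-distribʳ-* zero    m n = refl
^-distribʳ-* (suc o) m n = trans (cong (m * n *_) (^-distribʳ-* o m n)) (lemma m n (m ^ o) (n ^ o))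
  where
  lemma : ∀ m n p q → m * n * (p * q) ≡ m * p * (n * q)
  lemma = solve-∀

-- Bernoulli's inequality (1 + 1/j)^m ≥ 1 + m/j, cleared of denominators.
bernoulli : ∀ j m → j ^ m * (j + m) ≤ j * suc j ^ m
bernoulli j zero = ≤-reflexive (lemma j)
  where
  lemma : ∀ j → 1 * (j + 0) ≡ j * 1
  lemma = solve-∀
bernoulli j (suc m) = begin
    j * j ^ m * (j + suc m)             ≤⟨ m≤m+n _ (j ^ m * m) ⟩
    j * j ^ m * (j + suc m) + j ^ m * m ≡⟨ lemma₁ j m (j ^ m) ⟩
    suc j * (j ^ m * (j + m))           ≤⟨ *-monoʳ-≤ (suc j) (bernoulli j m) ⟩
    suc j * (j * suc j ^ m)             ≡⟨ lemma₂ j (suc j ^ m) ⟩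
    j * (suc j * suc j ^ m)             ∎
  where
  open ≤-Reasoning
  lemma₁ : ∀ j m p → j * p * (j + suc m) + p * m ≡ suc j * (p * (j + m))
  lemma₁ = solve-∀
  lemma₂ : ∀ j p → suc j * (j * p) ≡ j * (suc j * p)
  lemma₂ = solve-∀

2*j^j≤[1+j]^j : ∀ j → .{{_ : NonZero j}} → 2 * j ^ j ≤ suc j ^ j
2*j^j≤[1+j]^j j = *-cancelˡ-≤ j (begin
    j * (2 * j ^ j)  ≡⟨ lemma j (j ^ j) ⟩
    j ^ j * (j + j)  ≤⟨ bernoulli j j ⟩
    j * suc j ^ j    ∎)
  where
  open ≤-Reasoning
  lemma : ∀ j p → j * (2 * p) ≡ p * (j + j)
  lemma = solve-∀

-- Comparing `j`-th powers avoids roots: (1 + 1/j)^j ≥ 2 gives (1 + 1/j)^(mj) ≥ 2^m ≥ K^j.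
power-ratio : ∀ K m j → .{{_ : NonZero j}} → K ^ j ≤ 2 ^ m → K * j ^ m ≤ suc j ^ m
power-ratio K m j le = ^-cancelˡ-≤ j (begin
    (K * j ^ m) ^ j         ≡⟨ ^-distribʳ-* j K (j ^ m) ⟩
    K ^ j * (j ^ m) ^ j     ≤⟨ *-monoˡ-≤ _ le ⟩
    2 ^ m * (j ^ m) ^ j     ≡⟨ cong (2 ^ m *_) (^-comm-exp j m j) ⟩
    2 ^ m * (j ^ j) ^ m     ≡⟨ ^-distribʳ-* m 2 (j ^ j) ⟨
    (2 * j ^ j) ^ m         ≤⟨ ^-monoˡ-≤ m (2*j^j≤[1+j]^j j) ⟩
    (suc j ^ j) ^ m         ≡⟨ ^-comm-exp (suc j) j m ⟩
    (suc j ^ m) ^ j         ∎)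
  where open ≤-Reasoning

-- Telescopes `S-ratio` along the diagonal, gaining a factor `K` at each of the `s` steps. One power
-- hypothesis, at the far end, serves all of them.
S-chain : ∀ K ℓ s m j → .{{_ : NonZero j}} → 2 ≤ K → s + j ≤ ℓ → (K + ℓ) ^ (s + j) ≤ 2 ^ (s + m) →
  K ^ s * S m j ≤ S (s + m) (s + j)
S-chain K ℓ zero m j 2≤K s+j≤ℓ le = ≤-reflexive (+-identityʳ _)
S-chain K ℓ (suc s) m j 2≤K s+j≤ℓ le = begin
    K * K ^ s * S m j       ≡⟨ *-assoc K (K ^ s) (S m j) ⟩
    K * (K ^ s * S m j)     ≤⟨ *-monoʳ-≤ K (S-chain K ℓ s m j 2≤K (<⇒≤ s+j≤ℓ) le′) ⟩
    K * S (s + m) (s + j)   ≤⟨ S-ratio K (s + m) (s + j) (≤-trans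
                                 (*-monoˡ-≤ ((s + j) ^ (s + m)) (+-monoʳ-≤ K s+j≤ℓ))
                                 (power-ratio (K + ℓ) (s + m) (s + j) {{s+j≢0}} le′)) ⟩
    S (suc s + m) (suc s + j) ∎
  where
  open ≤-Reasoning
  s+j≢0 : NonZero (s + j)
  s+j≢0 = >-nonZero (≤-trans (>-nonZero⁻¹ j) (m≤n+m j s))
  le′ : (K + ℓ) ^ (s + j) ≤ 2 ^ (s + m)
  -- Going one step back divides the left side by `K + ℓ`, which is at least 2, and the right side
  -- by exactly 2.
  le′ = *-cancelˡ-≤ 2 (≤-trans (*-monoˡ-≤ ((K + ℓ) ^ (s + j)) (≤-trans 2≤K (m≤m+n K ℓ))) le)

j*S≤S-suc : ∀ m j → j * S m j ≤ S (suc m) j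
j*S≤S-suc m zero = z≤n
j*S≤S-suc m (suc j) = m≤m+n _ _

-- Nonzero `j` excludes the drop from `S 0 0`, which is 1, to `S 1 0`, which is 0.
S-mono : ∀ {m m′} j → .{{_ : NonZero j}} → m ≤ m′ → S m j ≤ S m′ j
S-mono {m} j le = go (≤⇒≤′ le)
  where
  go : ∀ {m′} → m ≤′ m′ → S m j ≤ S m′ j
  go ≤′-refl = ≤-refl
  go (≤′-step {m′} p) = ≤-trans (go p) (≤-trans (m≤n*m (S m′ j) j) (j*S≤S-suc m′ j))

S-diag : ∀ j → 1 ≤ S j j
S-diag zero = ≤-refl
S-diag (suc j) = ≤-trans (S-diag j) (m≤n+m _ _)

-- Starting from `j` points in separate blocks, each of the `d` further points may join any of the
-- `j` blocks.
S-power : ∀ d j → j ^ d ≤ S (d + j) j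
S-power zero j = S-diag j
S-power (suc d) j = ≤-trans (*-monoʳ-≤ j (S-power d j)) (j*S≤S-suc (d + j) j)

-- Counting by case distinction

lookup-injective : ∀ {A : Set} {xs : List A} → Unique xs → ∀ {i j} → lookup xs i ≡ lookup xs j → i ≡ j
lookup-injective (_ ∷ _)    {fzero}  {fzero}  eq = refl
lookup-injective (x∉ ∷ _)   {fzero}  {fsuc j} eq = contradiction eq (All.lookup x∉ (∈-lookup j))
lookup-injective (x∉ ∷ _)   {fsuc i} {fzero}  eq = contradiction (sym eq) (All.lookup x∉ (∈-lookup i))
lookup-injective (_ ∷ xs!)  {fsuc i} {fsuc j} eq = cong fsuc (lookup-injective xs! eq)

Unique⇒length-mono : ∀ {A : Set} {xs ys : List A} → Unique xs → (∀ {z} → z ∈ xs → z ∈ ys) →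
  length xs ≤ length ys
Unique⇒length-mono {xs = xs} {ys} xs! sub = injective⇒≤ {f = λ i → index (sub (∈-lookup i))} λ {i} {j} eq →
  lookup-injective xs! (begin
    lookup xs i                           ≡⟨ lookup-index (sub (∈-lookup i)) ⟩
    lookup ys (index (sub (∈-lookup i)))  ≡⟨ cong (lookup ys) eq ⟩
    lookup ys (index (sub (∈-lookup j)))  ≡⟨ lookup-index (sub (∈-lookup j)) ⟨
    lookup xs j                           ∎)
  where open ≡-Reasoning

map-++-injective : ∀ {A B : Set} {f : A → B} {zs} xs → Unique (map f xs ++ zs) →
  ∀ {x y} → x ∈ xs → y ∈ xs → f x ≡ f y → x ≡ y
map-++-injective (x ∷ xs) _ (here refl) (here refl) eq = refl
map-++-injective {f = f} (x ∷ xs) (x∉ ∷ _) (here refl) (there q) eq =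
  contradiction eq (All.lookup x∉ (∈-++⁺ˡ (∈-map⁺ f q)))
map-++-injective {f = f} (x ∷ xs) (x∉ ∷ _) (there p) (here refl) eq =
  contradiction (sym eq) (All.lookup x∉ (∈-++⁺ˡ (∈-map⁺ f p)))
map-++-injective (x ∷ xs) (_ ∷ xs!) (there p) (there q) eq = map-++-injective xs xs! p q eq

Unique-++-disjoint : ∀ {A : Set} {x : A} xs {ys} → Unique (xs ++ ys) → x ∈ xs → x ∉ ys
Unique-++-disjoint (x ∷ xs) (x∉ ∷ _) (here refl) q = All.lookup x∉ (∈-++⁺ʳ xs q) refl
Unique-++-disjoint (x ∷ xs) (_ ∷ xs!) (there p) q = Unique-++-disjoint xs xs! p q

-- An upper bound for the cardinality of a predicate that needs no enumeration of its elements and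
-- no decidability.
Bounded : {A : Set} → (A → Set) → ℕ → Set
Bounded Q c = ∀ G → Unique G → All Q G → length G ≤ c

module _ {A : Set} where

  Bounded-weaken : ∀ {Q Q′ : A → Set} {c d} → (∀ {a} → Q a → Q′ a) → c ≤ d → Bounded Q′ c → Bounded Q d
  Bounded-weaken Q⇒Q′ c≤d bd G G! QG = ≤-trans (bd G G! (All.map Q⇒Q′ QG)) c≤d

  Bounded-empty : ∀ {Q : A → Set} {c} → (∀ {a} → ¬ Q a) → Bounded Q c
  Bounded-empty ¬Q []      _ _        = z≤n
  Bounded-empty ¬Q (_ ∷ _) _ (q ∷ _)  = contradiction q ¬Q

  -- Allows a bound to be proved with a member at hand, since the empty list satisfies every bound.
  Bounded-inhabited : ∀ {Q : A → Set} {c} → (∀ {a} → Q a → Bounded Q c) → Bounded Q c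
  Bounded-inhabited bd []      _  _         = z≤n
  Bounded-inhabited bd (a ∷ G) G! (q ∷ QG)  = bd q (a ∷ G) G! (q ∷ QG)

  length-filter-¬ : ∀ {R : A → Set} (R? : Decidable R) xs →
    length xs ≡ length (filter R? xs) + length (filter (¬? ∘ R?) xs)
  length-filter-¬ R? [] = refl
  length-filter-¬ R? (x ∷ xs) with R? x
  ... | yes _ = cong suc (length-filter-¬ R? xs)
  ... | no _  = trans (cong suc (length-filter-¬ R? xs)) (sym (+-suc _ _))

  Bounded-split : ∀ {Q R : A → Set} {c d} → Decidable R →
    Bounded (λ a → Q a × R a) c → Bounded (λ a → Q a × ¬ R a) d → Bounded Q (c + d)
  Bounded-split R? bc bd G G! QG = ≤-trans (≤-reflexive (length-filter-¬ R? G)) (+-mono-≤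
    (bc _ (filter⁺ R? G!) (All.zip (All-filter⁺ R? QG , all-filter R? G)))
    (bd _ (filter⁺ (¬? ∘ R?) G!) (All.zip (All-filter⁺ (¬? ∘ R?) QG , all-filter (¬? ∘ R?) G))))

  -- A union bound. The alternatives may overlap: those satisfying `R b` are split off before the
  -- remaining ones are counted.
  Bounded-branch : ∀ {B : Set} {Q : A → Set} {R : B → A → Set} {c} → (∀ b → Decidable (R b)) → (bs : List B) →
    (∀ {a} → Q a → Any (λ b → R b a) bs) → All (λ b → Bounded (λ a → Q a × R b a) c) bs →
    Bounded Q (length bs * c)
  Bounded-branch R? []       some []        = Bounded-empty (λ q → case some q of λ ())
  Bounded-branch {Q = Q} {R} R? (b ∷ bs) some (bd ∷ bds) = Bounded-split (R? b) bd
    (Bounded-branch {Q = λ a → Q a × ¬ R b a} R? bs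
      (λ (q , ¬r) → case some q of λ { (here r) → contradiction r ¬r ; (there p) → p })
      (All.map (Bounded-weaken (λ ((q , _) , r) → q , r) ≤-refl) bds))

-- Partitions with prescribed parts

∈-parts⁺ : ∀ {n} (P : PMat n) x → part P x ∈ parts P
∈-parts⁺ P x = ∈-deduplicate⁺ _≟S_ (∈-toList⁺ (∈ᵥ-lookup x P))

∈-parts⁻ : ∀ {n} (P : PMat n) {B} → B ∈ parts P → ∃ λ x → B ≡ part P x
∈-parts⁻ P B∈ = VecAny.index p , VecAny.lookup-index p
  where p = ∈-toList⁻ (∈-deduplicate⁻ _≟S_ (Vec.toList P) B∈)

parts-! : ∀ {n} (P : PMat n) → Unique (parts P)
parts-! P = DecUnique.deduplicate-! _≟S_ (Vec.toList P)

PMat-ext : ∀ {n} {P P′ : PMat n} → (∀ x → part P x ≡ part P′ x) → P ≡ P′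
PMat-ext {P = P} {P′} eq = trans (sym (tabulate∘lookup P)) (trans (tabulate-cong eq) (tabulate∘lookup P′))

module _ {n : ℕ} where

  open DecMem (_≟S_ {n}) using (_∈?_)
  open IsPartition

  _⊆parts_ : List (Subset n) → PMat n → Set
  X ⊆parts P = All (_∈ parts P) X

  -- Q pins down the part of y: it is a prescribed one, or that of a representative.
  Located : (PMat n → Set) → List (Subset n) → List (Fin n) → Fin n → Set
  Located Q X reps y = (∃ λ B → B ∈ X × (∀ P → Q P → part P y ≡ B))
                     ⊎ (∃ λ r → r ∈ reps × (∀ P → Q P → part P y ≡ part P r))

  Located-⇒ : ∀ {Q Q′ X reps y} → (∀ {P} → Q′ P → Q P) → Located Q X reps y → Located Q′ X reps y
  Located-⇒ f (inj₁ (B , B∈ , eq)) = inj₁ (B , B∈ , λ P q → eq P (f q))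
  Located-⇒ f (inj₂ (r , r∈ , eq)) = inj₂ (r , r∈ , λ P q → eq P (f q))

  Located-∷ : ∀ {Q X reps x y} → Located Q X reps y → Located Q X (x ∷ reps) y
  Located-∷ (inj₁ l) = inj₁ l
  Located-∷ (inj₂ (r , r∈ , eq)) = inj₂ (r , there r∈ , eq)

  module _ {ℓ : ℕ} (X : List (Subset n)) where

    -- The part of a representative is not prescribed, so a point `z` in it is located by some
    -- representative `r′`. Different representatives have different parts, hence `r′` is `r`, and
    -- `z` lies with `r` in every member of `Q`.
    Located⇒part⊆ : ∀ {Q : PMat n → Set} {reps} →
      (∀ {P} → Q P → IsPartition n ℓ P) →
      (∀ {P} → Q P → Unique (map (part P) reps ++ X)) →
      (∀ y → Located Q X reps y) → ∀ {P P′} → Q P → Q P′ → ∀ {r z} → r ∈ reps → z ∈ₛ part P r → z ∈ₛ part P′ r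
    Located⇒part⊆ {Q} {reps} isP blocks! loc {P} {P′} q q′ {r} {z} r∈ z∈ with loc z
    ... | inj₁ (B , B∈ , eq) = contradiction B∈ (Unique-++-disjoint _ (blocks! q)
            (subst (_∈ map (part P) reps) (trans (sym (part-coh (isP q) r z z∈)) (eq P q)) (∈-map⁺ (part P) r∈)))
    ... | inj₂ (r′ , r′∈ , eq) = subst (z ∈ₛ_) (trans (eq P′ q′) (cong (part P′) r′≡r)) (self∈part (isP q′) z)
      where
      r′≡r : r′ ≡ r
      r′≡r = map-++-injective reps (blocks! q) r′∈ r∈ (trans (sym (eq P q)) (part-coh (isP q) r z z∈))

    Located⇒≡ : ∀ {Q : PMat n → Set} {reps} →
      (∀ {P} → Q P → IsPartition n ℓ P) →
      (∀ {P} → Q P → Unique (map (part P) reps ++ X)) →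
      (∀ y → Located Q X reps y) → ∀ {P P′} → Q P → Q P′ → P ≡ P′
    Located⇒≡ isP blocks! loc {P} {P′} q q′ = PMat-ext same
      where
      same : ∀ y → part P y ≡ part P′ y
      same y with loc y
      ... | inj₁ (B , _ , eq) = trans (eq P q) (sym (eq P′ q′))
      ... | inj₂ (r , r∈ , eq) = trans (eq P q) (trans
              (⊆-antisym (Located⇒part⊆ isP blocks! loc q q′ r∈) (Located⇒part⊆ isP blocks! loc q′ q r∈))
              (sym (eq P′ q′)))

    Bounded-extensions : ∀ todo reps e {Q : PMat n → Set} →
      (∀ {P} → Q P → IsPartition n ℓ P) →
      (∀ {P} → Q P → X ⊆parts P) →
      (∀ {P} → Q P → Unique (map (part P) reps ++ X)) →
      (∀ {P} → Q P → All (λ x → part P x ∉ X) todo) →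
      (∀ y → y ∈ todo ⊎ Located Q X reps y) →
      length reps + e + length X ≡ ℓ →
      Bounded Q (extensions (length todo) (length reps) e)
    Bounded-extensions [] reps zero isP X⊆ blocks! fresh loc size [] _ _ = z≤n
    Bounded-extensions [] reps zero isP X⊆ blocks! fresh loc size (_ ∷ []) _ _ = ≤-refl
    Bounded-extensions [] reps zero isP X⊆ blocks! fresh loc size (P ∷ P′ ∷ G) ((P≢P′ ∷ _) ∷ _) (q ∷ q′ ∷ _) =
      contradiction (Located⇒≡ isP blocks! (λ y → case loc y of λ { (inj₂ l) → l }) q q′) P≢P′
    -- All points are located, so the prescribed blocks and those of `reps` are the only possible
    -- parts: fewer than `ℓ`, and `Q` is empty.
    Bounded-extensions [] reps (suc e) {Q} isP X⊆ blocks! fresh loc size = Bounded-empty λ {P} q →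
      <⇒≱ (few q) (≤-reflexive (sym (numParts (isP q))))
      where
      few : ∀ {P} → Q P → length (parts P) < ℓ
      few {P} q = begin-strict
        length (parts P)                      ≤⟨ Unique⇒length-mono (parts-! P) covered ⟩
        length (map (part P) reps ++ X)       ≡⟨ length-++ (map (part P) reps) ⟩
        length (map (part P) reps) + length X ≡⟨ cong (_+ length X) (length-map (part P) reps) ⟩
        length reps + length X                <⟨ +-monoˡ-< (length X) (m<m+n (length reps) z<s) ⟩
        length reps + suc e + length X        ≡⟨ size ⟩
        ℓ                                     ∎
        where
        open ≤-Reasoning
        covered : ∀ {B} → B ∈ parts P → B ∈ map (part P) reps ++ X
        covered B∈ with ∈-parts⁻ P B∈
        ... | y , refl with loc y
        ... | inj₂ (inj₁ (B , B∈X , eq)) = ∈-++⁺ʳ (map (part P) reps) (subst (_∈ X) (sym (eq P q)) B∈X)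
        ... | inj₂ (inj₂ (r , r∈ , eq)) = ∈-++⁺ˡ (subst (_∈ map (part P) reps) (sym (eq P q)) (∈-map⁺ (part P) r∈))
    Bounded-extensions (x ∷ todo) reps e {Q} isP X⊆ blocks! fresh loc size = by-e e size
      where
      OldBlock : PMat n → Set
      OldBlock P = part P x ∈ map (part P) reps

      -- Branching over the representative whose block contains `x`; each choice makes `x` located.
      old : ∀ {e} → length reps + e + length X ≡ ℓ →
        Bounded (λ P → Q P × OldBlock P) (length reps * extensions (length todo) (length reps) e)
      old {e} size = Bounded-branch {R = λ r P → part P x ≡ part P r} (λ r P → part P x ≟S part P r) reps
        (λ {P} (_ , p) → case ∈-map⁻ (part P) p of λ (r , r∈ , eq) → lose r∈ eq)
        (All.tabulate λ {r} r∈ → Bounded-extensions todo reps e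
          (λ q → isP (proj₁ (proj₁ q))) (λ q → X⊆ (proj₁ (proj₁ q))) (λ q → blocks! (proj₁ (proj₁ q)))
          (λ q → All.tail (fresh (proj₁ (proj₁ q))))
          (λ y → case loc y of λ
            { (inj₁ (here refl)) → inj₂ (inj₂ (r , r∈ , λ _ q → proj₂ q))
            ; (inj₁ (there y∈)) → inj₁ y∈
            ; (inj₂ l) → inj₂ (Located-⇒ (λ q → proj₁ (proj₁ q)) l) })
          size)

      new! : ∀ {P} → Q P × ¬ OldBlock P → Unique (map (part P) (x ∷ reps) ++ X)
      new! {P} (q , ¬old) = All.tabulate (λ { B∈ refl → case ∈-++⁻ (map (part P) reps) B∈ of λ
        { (inj₁ o) → ¬old o ; (inj₂ B∈X) → All.head (fresh q) B∈X } }) ∷ blocks! q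

      by-e : ∀ e → length reps + e + length X ≡ ℓ → Bounded Q (extensions (suc (length todo)) (length reps) e)
      by-e zero size = Bounded-weaken (λ q → q) (≤-reflexive (+-identityʳ _))
        (Bounded-split (λ P → DecMem._∈?_ _≟S_ (part P x) (map (part P) reps)) (old size)
          -- With no block left to open, a new block for `x` would be part number `ℓ + 1`.
          (Bounded-empty λ {P} q → <⇒≱ (many q) (≤-reflexive (numParts (isP (proj₁ q))))))
        where
        many : ∀ {P} → Q P × ¬ OldBlock P → ℓ < length (parts P)
        many {P} q = begin-strict
          ℓ                                          ≡⟨ size ⟨
          length reps + 0 + length X                 ≡⟨ cong (_+ length X) (+-identityʳ (length reps)) ⟩
          length reps + length X                     ≡⟨ cong (_+ length X) (length-map (part P) reps) ⟨
          length (map (part P) reps) + length X      ≡⟨ length-++ (map (part P) reps) ⟨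
          length (map (part P) reps ++ X)            <⟨ Unique⇒length-mono (new! q) (λ B∈ →
                                                          case ∈-++⁻ (map (part P) (x ∷ reps)) B∈ of λ
                                                          { (inj₁ p) → case ∈-map⁻ (part P) p of λ { (z , _ , refl) → ∈-parts⁺ P z }
                                                          ; (inj₂ p) → All.lookup (X⊆ (proj₁ q)) p }) ⟩
          length (parts P)                           ∎
          where open ≤-Reasoning
      by-e (suc e) size = Bounded-split (λ P → DecMem._∈?_ _≟S_ (part P x) (map (part P) reps)) (old size)
        (Bounded-extensions todo (x ∷ reps) e (isP ∘ proj₁) (X⊆ ∘ proj₁) new!
          (All.tail ∘ fresh ∘ proj₁)
          (λ y → case loc y of λ
            { (inj₁ (here refl)) → inj₂ (inj₂ (x , here refl , λ _ _ → refl))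
            ; (inj₁ (there y∈)) → inj₁ y∈
            ; (inj₂ l) → inj₂ (Located-∷ (Located-⇒ (λ q → proj₁ q) l)) })
          (trans (cong (_+ length X) (sym (+-suc (length reps) e))) size))

  covered? : ∀ (X : List (Subset n)) (x : Fin n) → Dec (Any (x ∈ₛ_) X)
  covered? X x = any? (x ∈ₛ?_) X

  rest : List (Subset n) → List (Fin n)
  rest X = filter (¬? ∘ covered? X) (allFin n)

  part≡ : ∀ {ℓ P B x} → IsPartition n ℓ P → B ∈ parts P → x ∈ₛ B → part P x ≡ B
  part≡ {P = P} isP B∈ x∈ with ∈-parts⁻ P B∈
  ... | y , refl = part-coh isP y _ x∈

  Bounded-S : ∀ {ℓ} X → Unique X → length X ≤ ℓ →
    Bounded (λ P → IsPartition n ℓ P × X ⊆parts P) (S (length (rest X)) (ℓ ∸ length X))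
  Bounded-S {ℓ} X X! X≤ℓ = Bounded-weaken (λ q → q) (≤-reflexive (sym (S≡extensions (length (rest X)) (ℓ ∸ length X))))
    (Bounded-extensions X (rest X) [] (ℓ ∸ length X) proj₁ proj₂ (λ _ → X!)
      (λ (isP , X⊆) → All.tabulate λ {x} x∈ p → proj₂ (∈-filter⁻ (¬? ∘ covered? X) {xs = allFin n} x∈) (lose p (self∈part isP x)))
      loc (m∸n+n≡m X≤ℓ))
    where
    loc : ∀ y → y ∈ rest X ⊎ Located (λ P → IsPartition n ℓ P × X ⊆parts P) X [] y
    loc y with covered? X y
    ... | no ¬c = inj₁ (∈-filter⁺ (¬? ∘ covered? X) (∈-allFin y) ¬c)
    ... | yes c with find c
    ... | B , B∈ , y∈ = inj₂ (inj₁ (B , B∈ , λ _ (isP , X⊆) → part≡ isP (All.lookup X⊆ B∈) y∈))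

  rest-bound : ∀ X us → Unique us → All (λ u → Any (u ∈ₛ_) X) us → length (rest X) + length us ≤ n
  rest-bound X us us! cov = begin
    length (rest X) + length us  ≡⟨ length-++ (rest X) ⟨
    length (rest X ++ us)        ≤⟨ Unique⇒length-mono
                                      (Unique-++⁺ (filter⁺ (¬? ∘ covered? X) (allFin⁺ n)) us!
                                        (λ (p , q) → proj₂ (∈-filter⁻ (¬? ∘ covered? X) {xs = allFin n} p) (All.lookup cov q)))
                                      (λ {z} _ → ∈-allFin z) ⟩
    length (allFin n)            ≡⟨ length-tabulate (λ i → i) ⟩
    n                            ∎
    where open ≤-Reasoning

  representatives : ∀ {P X} → X ⊆parts P → ∃ λ ws → map (part P) ws ≡ X
  representatives [] = [] , refl
  representatives {P} (B∈ ∷ X⊆) with ∈-parts⁻ P B∈ | representatives X⊆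
  ... | w , refl | ws , refl = w ∷ ws , refl

  -- Extends `commonParts` to arbitrary lists of blocks: `meet (parts P) Q` is `commonParts P Q` by
  -- definition.
  meet : List (Subset n) → PMat n → ℕ
  meet X P = length (filter (λ B → B ∈? parts P) X)

  meet-full : ∀ X P → length X ≤ meet X P → X ⊆parts P
  meet-full X P le with all? (λ B → B ∈? parts P) X
  ... | yes X⊆ = X⊆
  ... | no ¬X⊆ = contradiction le (<⇒≱ (filter-notAll (λ B → B ∈? parts P) X (¬All⇒Any¬ (λ B → B ∈? parts P) X ¬X⊆)))

-- Covers

removals : {A : Set} → List A → List (List A)
removals []       = []
removals (x ∷ xs) = xs ∷ map (x ∷_) (removals xs)

length-removals : {A : Set} (xs : List A) → length (removals xs) ≡ length xs
length-removals [] = refl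
length-removals (x ∷ xs) = cong suc (trans (length-map (x ∷_) (removals xs)) (length-removals xs))

removals-length : {A : Set} (xs : List A) {ys : List A} → ys ∈ removals xs → length xs ≡ suc (length ys)
removals-length (x ∷ xs) (here refl) = refl
removals-length (x ∷ xs) (there p) with ∈-map⁻ (x ∷_) p
... | ys , q , refl = cong suc (removals-length xs q)

removals-All : {A : Set} {R : A → Set} (xs : List A) {ys : List A} → ys ∈ removals xs → All R xs → All R ys
removals-All (x ∷ xs) (here refl) (_ ∷ r) = r
removals-All (x ∷ xs) (there p) (rx ∷ r) with ∈-map⁻ (x ∷_) p
... | ys , q , refl = rx ∷ removals-All xs q r

removals-! : {A : Set} (xs : List A) {ys : List A} → ys ∈ removals xs → Unique xs → Unique ys
removals-! (x ∷ xs) (here refl) (_ ∷ xs!) = xs!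
removals-! (x ∷ xs) (there p) (x∉ ∷ xs!) with ∈-map⁻ (x ∷_) p
... | ys , q , refl = removals-All xs q x∉ ∷ removals-! xs q xs!

module _ {n : ℕ} where

  open DecMem (_≟S_ {n}) using (_∈?_)
  open IsPartition

  meet-∷ : ∀ {B : Subset n} {P} X → B ∈ parts P → meet (B ∷ X) P ≡ suc (meet X P)
  meet-∷ {B} {P} X B∈ with B ∈? parts P
  ... | yes _ = refl
  ... | no B∉ = contradiction B∈ B∉

  -- Scanning the list, delete the first block that is no part of `P`, unless `t` parts of `P` have
  -- been passed already; then the next block can go.
  removals-meet : ∀ {P} t (X : List (Subset n)) → t < length X → t ≤ meet X P →
    Any (λ Y → t ≤ meet Y P) (removals X)
  removals-meet {P} zero (B ∷ X) _ _ = here z≤n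
  removals-meet {P} (suc t) (B ∷ X) (s≤s t<) t≤ with B ∈? parts P
  ... | no B∉ = here t≤
  ... | yes B∈ with find (removals-meet t X t< (s≤s⁻¹ t≤))
  ... | Y , Y∈ , le = there (lose (∈-map⁺ (B ∷_) Y∈) (≤-trans (s≤s le) (≤-reflexive (sym (meet-∷ Y B∈)))))

  -- Each of the `s` deletions has at most `ℓ` choices. When `t` blocks remain and `P` still meets
  -- them in `t`, all of them are parts of `P`.
  Bounded-shrink : ∀ {Q : PMat n → Set} {ℓ t c} → ∀ s X → length X ≡ s + t → length X ≤ ℓ → Unique X →
    (∀ Y → length Y ≡ t → Unique Y → Bounded (λ P → Q P × Y ⊆parts P) c) →
    Bounded (λ P → Q P × t ≤ meet X P) (ℓ ^ s * c)
  Bounded-shrink {t = t} zero X refl X≤ℓ X! bd = Bounded-weaken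
    (λ {P} (q , le) → q , meet-full X P le) (≤-reflexive (sym (*-identityˡ _))) (bd X refl X!)
  Bounded-shrink {ℓ = ℓ} {t} {c} (suc s) X eq X≤ℓ X! bd = Bounded-weaken (λ q → q)
    (≤-trans (*-monoˡ-≤ (ℓ ^ s * c) (≤-trans (≤-reflexive (length-removals X)) X≤ℓ)) (≤-reflexive (sym (*-assoc ℓ (ℓ ^ s) c))))
    (Bounded-branch {R = λ Y P → t ≤ meet Y P} (λ Y P → t ≤? meet Y P) (removals X)
      (λ {P} (_ , le) → removals-meet t X (subst (t <_) (sym eq) (s≤s (m≤n+m t s))) le)
      (All.tabulate λ {Y} Y∈ → Bounded-weaken (λ ((q , _) , r) → q , r) ≤-refl
        (Bounded-shrink s Y (suc-injective (trans (sym (removals-length X Y∈)) eq))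
          (≤-trans (n≤1+n _) (≤-trans (≤-reflexive (sym (removals-length X Y∈))) X≤ℓ))
          (removals-! X Y∈ X!) bd)))

  Cover : ℕ → List (PMat n) → List (Subset n) → Set
  Cover t F X = All (λ P → t ≤ meet X P) F

  -- If every common part of `G` and `P` lay in `X`, these at least `t` parts would all count
  -- towards `meet X G`.
  escape : ∀ {t P G X} → t ≤ commonParts G P → ¬ t ≤ meet X G →
    Any (λ B → B ∈ parts P × B ∉ X) (parts G)
  escape {P = P} {G} {X} t≤ t≰ with any? (λ B → (B ∈? parts P) ×-dec (¬? (B ∈? X))) (parts G)
  ... | yes p = p
  ... | no ¬p = contradiction (≤-trans t≤ (Unique⇒length-mono (filter⁺ (λ B → B ∈? parts P) (parts-! G)) inside)) t≰
    where
    inside : ∀ {B} → B ∈ filter (λ B → B ∈? parts P) (parts G) → B ∈ filter (λ B → B ∈? parts G) X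
    inside {B} B∈ with ∈-filter⁻ (λ B → B ∈? parts P) {xs = parts G} B∈ | B ∈? X
    ... | B∈G , B∈P | yes B∈X = ∈-filter⁺ (λ B → B ∈? parts G) B∈X B∈G
    ... | B∈G , B∈P | no B∉X = contradiction (lose B∈G (B∈P , B∉X)) ¬p

  module _ {ℓ t : ℕ} (F : List (PMat n)) (isP : All (IsPartition n ℓ) F)
    (int : ∀ P Q → P ∈ F → Q ∈ F → t ≤ commonParts P Q) where

    -- While `Y` is too small to be a cover, some `G` in `F` meets it in fewer than `t` blocks. By
    -- `escape`, every `P` containing `Y` has one of the `ℓ` parts of `G` as a further block.
    Bounded-grow : ∀ {s c} →
      (∀ {s′} → s′ < s → ∀ Y → length Y ≡ s′ + t → Unique Y → ¬ Cover t F Y) →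
      (∀ Z → length Z ≡ s + t → Unique Z → Bounded (λ P → P ∈ F × Z ⊆parts P) c) →
      ∀ d {s′} → d + s′ ≡ s → ∀ Y → length Y ≡ s′ + t → Unique Y →
      Bounded (λ P → P ∈ F × Y ⊆parts P) (ℓ ^ d * c)
    Bounded-grow noCover bd zero refl Y eq Y! = Bounded-weaken (λ q → q) (≤-reflexive (sym (*-identityˡ _))) (bd Y eq Y!)
    Bounded-grow {c = c} noCover bd (suc d) {s′} refl Y eq Y!
      with find (¬All⇒Any¬ (λ P → t ≤? meet Y P) F (noCover (s≤s (m≤n+m s′ d)) Y eq Y!))
    ... | G , G∈ , t≰ = Bounded-weaken (λ q → q)
      (≤-reflexive (trans (cong (_* (ℓ ^ d * c)) (numParts (All.lookup isP G∈))) (sym (*-assoc ℓ (ℓ ^ d) c))))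
      (Bounded-branch {R = λ B P → B ∈ parts P × B ∉ Y} (λ B P → (B ∈? parts P) ×-dec (¬? (B ∈? Y))) (parts G)
        (λ {P} (P∈ , _) → escape {P = P} {G} (int G P G∈ P∈) t≰)
        -- That `B` is new, which keeps the enlarged list duplicate-free, is known only from a
        -- member of the branch.
        (All.tabulate λ {B} _ → Bounded-inhabited λ (_ , (_ , B∉Y)) → Bounded-weaken
          (λ ((P∈ , Y⊆) , (B∈ , _)) → P∈ , B∈ ∷ Y⊆) ≤-refl
          (Bounded-grow noCover bd d (+-suc d s′) (B ∷ Y) (cong suc eq)
            (All.tabulate (λ { p refl → B∉Y p }) ∷ Y!))))

-- Numerical bounds

n^2ℓ≤2^n⇒2ℓ≤n : ∀ {n ℓ} → 2 ≤ n → n ^ (2 * ℓ) ≤ 2 ^ n → 2 * ℓ ≤ n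
n^2ℓ≤2^n⇒2ℓ≤n {n} {ℓ} 2≤n le with 2 * ℓ ≤? n
... | yes p = p
... | no p = contradiction (≤-trans (^-monoˡ-≤ (2 * ℓ) 2≤n) le) (<⇒≱ (^-monoʳ-< 2 (s≤s (s≤s z≤n)) (≰⇒> p)))

module _ {n ℓ : ℕ} (1≤ℓ : 1 ≤ ℓ) (2≤n : 2 ≤ n) (le : n ^ (2 * ℓ) ≤ 2 ^ n) where

  private
    2ℓ≤n : 2 * ℓ ≤ n
    2ℓ≤n = n^2ℓ≤2^n⇒2ℓ≤n {n} {ℓ} 2≤n le

    -- Each level of the cover costs a factor `ℓ` for shrinking and another for growing; the 2
    -- yields the half in the final bound.
    K = 2 * (ℓ * ℓ)

    2≤K : 2 ≤ K
    2≤K = *-monoʳ-≤ 2 (*-mono-≤ 1≤ℓ 1≤ℓ)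

  -- `K + ℓ` is at most `(2 * ℓ) ^ 2`, hence at most `n ^ 2`.
  base-power : (K + ℓ) ^ ℓ ≤ 2 ^ n
  base-power = begin
    (K + ℓ) ^ ℓ        ≤⟨ ^-monoˡ-≤ ℓ (begin
      K + ℓ              ≤⟨ +-monoʳ-≤ K (≤-trans (m≤m*n ℓ ℓ {{>-nonZero 1≤ℓ}}) (m≤n*m (ℓ * ℓ) 2)) ⟩
      K + K              ≡⟨ square ℓ ⟩
      (2 * ℓ) * (2 * ℓ)  ≤⟨ *-mono-≤ 2ℓ≤n 2ℓ≤n ⟩
      n * n              ≡⟨ cong (n *_) (*-identityʳ n) ⟨
      n ^ 2              ∎) ⟩
    (n ^ 2) ^ ℓ        ≡⟨ ^-*-assoc n 2 ℓ ⟩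
    n ^ (2 * ℓ)        ≤⟨ le ⟩
    2 ^ n              ∎
    where
    open ≤-Reasoning
    square : ∀ ℓ → 2 * (ℓ * ℓ) + 2 * (ℓ * ℓ) ≡ (2 * ℓ) * (2 * ℓ)
    square = solve-∀

  branching-bound : ∀ {s t m j} → s + j + t ≡ ℓ → s + m + t ≡ n → 1 ≤ s → 1 ≤ j →
    2 * (ℓ ^ s * (ℓ ^ s * S m j)) ≤ S (s + m) (s + j)
  branching-bound {s} {t} {m} {j} eqℓ eqn 1≤s 1≤j = begin
    2 * (ℓ ^ s * (ℓ ^ s * S m j))     ≤⟨ *-monoˡ-≤ (ℓ ^ s * (ℓ ^ s * S m j)) (^-monoʳ-≤ 2 1≤s) ⟩
    2 ^ s * (ℓ ^ s * (ℓ ^ s * S m j)) ≡⟨ reassoc (2 ^ s) (ℓ ^ s) (S m j) ⟩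
    2 ^ s * (ℓ ^ s * ℓ ^ s) * S m j   ≡⟨ cong (λ z → 2 ^ s * z * S m j) (^-distribʳ-* s ℓ ℓ) ⟨
    2 ^ s * (ℓ * ℓ) ^ s * S m j       ≡⟨ cong (_* S m j) (^-distribʳ-* s 2 (ℓ * ℓ)) ⟨
    K ^ s * S m j                     ≤⟨ S-chain K ℓ s m j {{>-nonZero 1≤j}} 2≤K
                                           (≤-trans (m≤m+n (s + j) t) (≤-reflexive eqℓ)) power ⟩
    S (s + m) (s + j)                 ∎
    where
    open ≤-Reasoning
    reassoc : ∀ a b c → a * (b * (b * c)) ≡ a * (b * b) * c
    reassoc = solve-∀
    power : (K + ℓ) ^ (s + j) ≤ 2 ^ (s + m)
    -- Multiplying by `2 ^ t`, at most `(K + ℓ) ^ t`, restores the exponents `ℓ` and `n` of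
    -- `base-power`.
    power = *-cancelʳ-≤ _ _ (2 ^ t) {{m^n≢0 2 t}} (begin
      (K + ℓ) ^ (s + j) * 2 ^ t         ≤⟨ *-monoʳ-≤ ((K + ℓ) ^ (s + j)) (^-monoˡ-≤ t (≤-trans 2≤K (m≤m+n K ℓ))) ⟩
      (K + ℓ) ^ (s + j) * (K + ℓ) ^ t   ≡⟨ ^-distribˡ-+-* (K + ℓ) (s + j) t ⟨
      (K + ℓ) ^ (s + j + t)             ≡⟨ cong ((K + ℓ) ^_) eqℓ ⟩
      (K + ℓ) ^ ℓ                       ≤⟨ base-power ⟩
      2 ^ n                             ≡⟨ cong (2 ^_) eqn ⟨
      2 ^ (s + m + t)                   ≡⟨ ^-distribˡ-+-* 2 (s + m) t ⟩
      2 ^ (s + m) * 2 ^ t               ∎)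

  -- For covers of full size `ℓ`. As `s` is at least 2, `S (d + s) s` is at least `2 ^ d`, and the
  -- left side times `2 ^ ℓ` is at most `(2 * ℓ) ^ (2 * ℓ)`, hence at most `2 ^ n`.
  full-branching-bound : ∀ {s d} → 2 ≤ s → s ≤ ℓ → d + ℓ ≡ n →
    2 * (ℓ ^ s * (ℓ ^ s * 1)) ≤ S (d + s) s
  full-branching-bound {s} {d} 2≤s s≤ℓ eqn = begin
    2 * (ℓ ^ s * (ℓ ^ s * 1)) ≤⟨ *-cancelʳ-≤ _ _ (2 ^ ℓ) {{m^n≢0 2 ℓ}} scaled ⟩
    2 ^ d                     ≤⟨ ^-monoˡ-≤ d 2≤s ⟩
    s ^ d                     ≤⟨ S-power d s ⟩
    S (d + s) s               ∎
    where
    open ≤-Reasoning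
    instance
      ℓ≢0 : NonZero ℓ
      ℓ≢0 = >-nonZero 1≤ℓ
    rearrange : ∀ p q → 2 * (p * (p * 1)) * q ≡ (p * p) * (2 * q)
    rearrange = solve-∀
    ℓ^s≤ℓ^ℓ : ℓ ^ s ≤ ℓ ^ ℓ
    ℓ^s≤ℓ^ℓ = ^-monoʳ-≤ ℓ s≤ℓ
    1+ℓ≤2ℓ : suc ℓ ≤ 2 * ℓ
    1+ℓ≤2ℓ = ≤-trans (+-monoˡ-≤ ℓ 1≤ℓ) (≤-reflexive (cong (ℓ +_) (sym (+-identityʳ ℓ))))
    ℓ^ℓ² : ℓ ^ ℓ * ℓ ^ ℓ ≡ ℓ ^ (2 * ℓ)
    ℓ^ℓ² = trans (sym (^-distribˡ-+-* ℓ ℓ ℓ)) (cong (λ z → ℓ ^ (ℓ + z)) (sym (+-identityʳ ℓ)))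
    scaled : 2 * (ℓ ^ s * (ℓ ^ s * 1)) * 2 ^ ℓ ≤ 2 ^ d * 2 ^ ℓ
    scaled = begin
      2 * (ℓ ^ s * (ℓ ^ s * 1)) * 2 ^ ℓ ≡⟨ rearrange (ℓ ^ s) (2 ^ ℓ) ⟩
      (ℓ ^ s * ℓ ^ s) * 2 ^ suc ℓ       ≤⟨ *-mono-≤ (*-mono-≤ ℓ^s≤ℓ^ℓ ℓ^s≤ℓ^ℓ) (^-monoʳ-≤ 2 1+ℓ≤2ℓ) ⟩
      (ℓ ^ ℓ * ℓ ^ ℓ) * 2 ^ (2 * ℓ)     ≡⟨ cong (_* 2 ^ (2 * ℓ)) ℓ^ℓ² ⟩
      ℓ ^ (2 * ℓ) * 2 ^ (2 * ℓ)         ≡⟨ ^-distribʳ-* (2 * ℓ) ℓ 2 ⟨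
      (ℓ * 2) ^ (2 * ℓ)                 ≤⟨ ^-monoˡ-≤ (2 * ℓ) (≤-trans (≤-reflexive (*-comm ℓ 2)) 2ℓ≤n) ⟩
      n ^ (2 * ℓ)                       ≤⟨ le ⟩
      2 ^ n                             ≡⟨ cong (2 ^_) eqn ⟨
      2 ^ (d + ℓ)                       ≡⟨ ^-distribˡ-+-* 2 d ℓ ⟩
      2 ^ d * 2 ^ ℓ                     ∎

S-zero : ∀ m → S m 0 ≤ 1
S-zero zero = ≤-refl
S-zero (suc m) = z≤n

-- Families containing given blocks

module _ {n ℓ : ℕ} where

  open IsPartition

  representatives-! : ∀ {P : PMat n} {X} ws → map (part P) ws ≡ X → Unique X → Unique ws
  representatives-! ws refl X! = map⁻ X!

  representatives-covered : ∀ {P : PMat n} {X} → IsPartition n ℓ P → ∀ ws → map (part P) ws ≡ X →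
    All (λ w → Any (w ∈ₛ_) X) ws
  representatives-covered {P} isP ws refl = All.tabulate λ {w} w∈ → lose (∈-map⁺ (part P) w∈) (self∈part isP w)

  rest+length≤n : ∀ {P : PMat n} {X} → IsPartition n ℓ P → Unique X → X ⊆parts P → length (rest X) + length X ≤ n
  rest+length≤n {P} {X} isP X! X⊆ with representatives {P = P} X⊆
  ... | ws , eq = ≤-trans
    (≤-reflexive (cong (length (rest X) +_) (trans (cong length (sym eq)) (length-map (part P) ws))))
    (rest-bound X ws (representatives-! {P} ws eq X!) (representatives-covered {P} isP ws eq))

  -- A member containing `X` shows that its blocks have distinct representatives, so at most
  -- `n ∸ length X` points are left. Strictness keeps the second argument of `S` positive for
  -- `S-mono`.
  Bounded-containing : ∀ X → Unique X → length X < ℓ →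
    Bounded (λ P → IsPartition n ℓ P × X ⊆parts P) (S (n ∸ length X) (ℓ ∸ length X))
  Bounded-containing X X! X<ℓ = Bounded-inhabited λ {P} (isP , X⊆) → Bounded-weaken (λ q → q)
    (S-mono (ℓ ∸ length X) {{>-nonZero (m<n⇒0<n∸m X<ℓ)}} (m+n≤o⇒m≤o∸n (length (rest X)) (rest+length≤n {P} isP X! X⊆)))
    (Bounded-S X X! (<⇒≤ X<ℓ))

  -- A partition is determined by all its parts; S (n ∸ ℓ) 0 would be wrong here,
  -- since it vanishes for ℓ < n.
  Bounded-containing-all : ∀ X → Unique X → length X ≡ ℓ →
    Bounded (λ P → IsPartition n ℓ P × X ⊆parts P) 1
  Bounded-containing-all X X! eq = Bounded-weaken (λ q → q)
    (≤-trans (≤-reflexive (cong (S (length (rest X))) (trans (cong (ℓ ∸_) eq) (n∸n≡0 ℓ)))) (S-zero (length (rest X))))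
    (Bounded-S X X! (≤-reflexive eq))

-- Families with `t` blocks in common

FixedSingletons : ∀ {n} → ℕ → List (PMat n) → Set
FixedSingletons {n} t F = Σ (Fin t → Fin n) λ xs → Injective _≡_ _≡_ xs ×
  (∀ P → P ∈ F → ∀ i → HasSingletonPart P (xs i))

other-element : ∀ {n ℓ} {P : PMat n} {w} → IsPartition n ℓ P → part P w ≢ ⁅ w ⁆ → ∃ λ w′ → w′ ∈ₛ part P w × w′ ≢ w
other-element {P = P} {w} isP ≢w with anyFin? (λ w′ → (w′ ∈ₛ? part P w) ×-dec ¬? (w′ ≟ w))
... | yes p = p
... | no ¬p = contradiction (⊆-antisym to from) ≢w
  where
  to : ∀ {z} → z ∈ₛ part P w → z ∈ₛ ⁅ w ⁆
  to {z} z∈ with z ≟ w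
  ... | yes refl = x∈⁅x⁆ w
  ... | no z≢w = contradiction (z , z∈ , z≢w) ¬p
  from : ∀ {z} → z ∈ₛ ⁅ w ⁆ → z ∈ₛ part P w
  from {z} z∈ rewrite x∈⁅y⁆⇒x≡y w z∈ = IsPartition.self∈part isP w

module _ {n ℓ t : ℕ} (2≤ℓ∸t : 2 ≤ ℓ ∸ t) {F : List (PMat n)} (F! : Unique F) (isP : All (IsPartition n ℓ) F) where

  open IsPartition

  private
    t<ℓ : t < ℓ
    t<ℓ = m∸n≢0⇒n<m {ℓ} {t} λ eq → contradiction (subst (2 ≤_) eq 2≤ℓ∸t) λ ()

  -- Some block of `X` is no singleton, so besides `t` representatives it covers a further point
  -- `w′`. Handing this spare point back to the Stirling number gains the factor `ℓ ∸ t`, which is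
  -- at least 2.
  trivially-intersecting : ∀ X → length X ≡ t → Unique X → (∀ {P} → P ∈ F → X ⊆parts P) →
    ¬ FixedSingletons t F → ∀ {P₀} → P₀ ∈ F → 2 * length F ≤ S (n ∸ t) (ℓ ∸ t)
  trivially-intersecting X refl X! X⊆ ¬fixed {P₀} P₀∈ with representatives {P = P₀} (X⊆ P₀∈)
  ... | ws , refl with all? (λ w → part P₀ w ≟S ⁅ w ⁆) ws
  ... | yes single = contradiction (subst (λ t → FixedSingletons t F) (sym (length-map (part P₀) ws))
          (lookup ws , lookup-injective (map⁻ X!) , λ P P∈ i → part≡ (All.lookup isP P∈)
            (subst (_∈ parts P) (All.lookup single (∈-lookup i)) (All.lookup (X⊆ P∈) (∈-map⁺ (part P₀) (∈-lookup i))))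
            (x∈⁅x⁆ _))) ¬fixed
  ... | no ¬single with find (¬All⇒Any¬ (λ w → part P₀ w ≟S ⁅ w ⁆) ws ¬single)
  ... | w , w∈ , ≢w with other-element (All.lookup isP P₀∈) ≢w
  ... | w′ , w′∈ , w′≢w = begin
      2 * length F                     ≤⟨ *-mono-≤ 2≤ℓ∸t (Bounded-S X X! (<⇒≤ t<ℓ) F F! (All.tabulate λ P∈ → All.lookup isP P∈ , X⊆ P∈)) ⟩
      (ℓ ∸ t) * S (length (rest X)) (ℓ ∸ t) ≤⟨ j*S≤S-suc (length (rest X)) (ℓ ∸ t) ⟩
      S (suc (length (rest X))) (ℓ ∸ t)  ≤⟨ S-mono (ℓ ∸ t) {{>-nonZero (≤-trans (s≤s z≤n) 2≤ℓ∸t)}} (m+n≤o⇒m≤o∸n (suc (length (rest X))) smaller) ⟩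
      S (n ∸ t) (ℓ ∸ t)                ∎
    where
    open ≤-Reasoning
    isP₀ = All.lookup isP P₀∈
    w′-part : part P₀ w′ ≡ part P₀ w
    w′-part = part-coh isP₀ w w′ w′∈
    -- Representatives in the same part coincide, and `w′` shares the part of `w`.
    w′∉ws : w′ ∉ ws
    w′∉ws p = w′≢w (map-++-injective {f = part P₀} {zs = []} ws (subst Unique (sym (++-identityʳ _)) X!) p w∈ w′-part)
    smaller : suc (length (rest X)) + length X ≤ n
    smaller = begin
      suc (length (rest X) + length X)     ≡⟨ +-suc (length (rest X)) (length X) ⟨
      length (rest X) + suc (length X)     ≡⟨ cong (λ z → length (rest X) + suc z) (length-map (part P₀) ws) ⟩
      length (rest X) + length (w′ ∷ ws)   ≤⟨ rest-bound X (w′ ∷ ws) (All.tabulate (λ { p refl → w′∉ws p }) ∷ map⁻ X!)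
           (lose (∈-map⁺ (part P₀) w∈) w′∈ ∷ representatives-covered {P = P₀} isP₀ ws refl) ⟩
      n                                    ∎

  fixed-singletons-bound : FixedSingletons t F → length F ≤ S (n ∸ t) (ℓ ∸ t)
  fixed-singletons-bound (xs , inj , single) = subst (λ k → length F ≤ S (n ∸ k) (ℓ ∸ k)) len
    (Bounded-containing X X! (subst (_< ℓ) (sym len) t<ℓ) F F!
      (All.tabulate λ {P} P∈ → All.lookup isP P∈ , All.tabulate λ B∈ → case ∈-map⁻ (λ i → ⁅ xs i ⁆) B∈ of λ
        { (i , _ , refl) → subst (_∈ parts P) (single P P∈ i) (∈-parts⁺ P (xs i)) }))
    where
    X = map (λ i → ⁅ xs i ⁆) (allFin t)
    len : length X ≡ t
    len = trans (length-map _ (allFin t)) (length-tabulate (λ i → i))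
    X! : Unique X
    X! = map⁺ (λ {i} {j} eq → inj (x∈⁅y⁆⇒x≡y (xs j) (subst (xs i ∈ₛ_) eq (x∈⁅x⁆ (xs i))))) (allFin⁺ t)

-- The condition n ≥ 2ℓ log_2 n is stated with the logarithm cleared, and a family is a
-- duplicate-free list.
theorem4 : (n ℓ t : ℕ) → 1 ≤ n → 1 ≤ ℓ → 1 ≤ t → t + 2 ≤ ℓ →
    n ^ (2 * ℓ) ≤ 2 ^ n → 48 ≤ n →
    (F : List (PMat n)) → Unique F → All (IsPartition n ℓ) F →
    (∀ P Q → P ∈ F → Q ∈ F → t ≤ commonParts P Q) →
    (length F ≤ S (n ∸ t) (ℓ ∸ t))
    × (¬ (Σ (Fin t → Fin n) λ xs → Injective _≡_ _≡_ xs ×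
    (∀ P → P ∈ F → ∀ i → HasSingletonPart P (xs i)))
    → 2 * length F ≤ S (n ∸ t) (ℓ ∸ t))
theorem4 n ℓ t 1≤n 1≤ℓ 1≤t t+2≤ℓ le 48≤n F F! isP int =
    -- Whether the family has fixed singletons is not decided: a failure of the bound rules them
    -- out, and `nontrivial` then contradicts the failure.
    decidable-stable (_ ≤? _) (λ ¬le → ¬le (≤-trans (m≤n*m (length F) 2)
      (nontrivial λ fixed → ¬le (fixed-singletons-bound 2≤ℓ∸t F! isP fixed))))
  , nontrivial
  where
  2≤n : 2 ≤ n
  2≤n = ≤-trans (s≤s (s≤s z≤n)) 48≤n
  t≤ℓ : t ≤ ℓ
  t≤ℓ = ≤-trans (m≤m+n t 2) t+2≤ℓ
  2≤ℓ∸t : 2 ≤ ℓ ∸ t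
  2≤ℓ∸t = m+n≤o⇒m≤o∸n 2 (≤-trans (≤-reflexive (+-comm 2 t)) t+2≤ℓ)
  ℓ≤n : ℓ ≤ n
  ℓ≤n = ≤-trans (m≤n*m ℓ 2) (n^2ℓ≤2^n⇒2ℓ≤n {n} {ℓ} 2≤n le)

  nontrivial : ¬ FixedSingletons t F → 2 * length F ≤ S (n ∸ t) (ℓ ∸ t)
  nontrivial ¬fixed = decidable-stable (_ ≤? _) λ ¬le → absurd ¬le F refl
    where
    module _ (¬le : ¬ 2 * length F ≤ S (n ∸ t) (ℓ ∸ t)) {P₀} (P₀∈ : P₀ ∈ F) where

      -- Existence of a minimal cover is not decided: instead, strong induction
      -- on the size refutes all covers, using that the goal is stable.
      NoCover : ℕ → Set
      NoCover s = s + t ≤ ℓ → ∀ X → length X ≡ s + t → Unique X → ¬ Cover t F X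

      noCover-step : ∀ s → (∀ {s′} → s′ < s → NoCover s′) → NoCover s
      noCover-step zero rec _ X eq X! cov = ¬le (trivially-intersecting 2≤ℓ∸t F! isP X eq X!
        (λ {P} P∈ → meet-full X P (≤-trans (≤-reflexive eq) (All.lookup cov P∈))) ¬fixed P₀∈)
      noCover-step s@(suc _) rec s+t≤ℓ X eq X! cov = ¬le (by-size (s + t <? ℓ))
        where
        -- One factor `ℓ ^ s` shrinks the cover to `t` common blocks; the other grows these back to
        -- `s + t` blocks, as no smaller cover exists.
        bounded : ∀ {c} → (∀ Z → length Z ≡ s + t → Unique Z → Bounded (λ P → IsPartition n ℓ P × Z ⊆parts P) c) →
          length F ≤ ℓ ^ s * (ℓ ^ s * c)
        bounded bd = Bounded-shrink {Q = _∈ F} s X eq (≤-trans (≤-reflexive eq) s+t≤ℓ) X!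
          (λ Y eqY Y! → Bounded-grow F isP int
            (λ s′<s → rec s′<s (≤-trans (+-monoˡ-≤ t (<⇒≤ s′<s)) s+t≤ℓ))
            (λ Z eqZ Z! → Bounded-weaken (λ (P∈ , Z⊆) → All.lookup isP P∈ , Z⊆) ≤-refl (bd Z eqZ Z!))
            s (+-identityʳ s) Y eqY Y!)
          F F! (All.tabulate λ P∈ → P∈ , All.lookup cov P∈)

        cancel : ∀ {a b} → a + t ≡ b → a ≡ b ∸ t
        cancel {a} refl = sym (m+n∸n≡m a t)

        shift : ∀ {o} → s + t ≤ o → s + (o ∸ (s + t)) + t ≡ o
        shift {o} s+t≤o = trans (rotate s (o ∸ (s + t)) t) (m∸n+n≡m s+t≤o)
          where
          rotate : ∀ s m t → s + m + t ≡ m + (s + t)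
          rotate = solve-∀

        by-size : Dec (s + t < ℓ) → 2 * length F ≤ S (n ∸ t) (ℓ ∸ t)
        by-size (yes s+t<ℓ) = begin
          2 * length F                                                  ≤⟨ *-monoʳ-≤ 2 (bounded λ Z eqZ Z! →
            subst (λ k → Bounded (λ P → IsPartition n ℓ P × Z ⊆parts P) (S (n ∸ k) (ℓ ∸ k))) eqZ
              (Bounded-containing Z Z! (subst (_< ℓ) (sym eqZ) s+t<ℓ))) ⟩
          2 * (ℓ ^ s * (ℓ ^ s * S (n ∸ (s + t)) (ℓ ∸ (s + t))))         ≤⟨ branching-bound 1≤ℓ 2≤n le {s} {t}
                                                                             (shift (<⇒≤ s+t<ℓ)) (shift (≤-trans s+t≤ℓ ℓ≤n)) (s≤s z≤n) (m<n⇒0<n∸m s+t<ℓ) ⟩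
          S (s + (n ∸ (s + t))) (s + (ℓ ∸ (s + t)))                     ≡⟨ cong₂ S (cancel (shift (≤-trans s+t≤ℓ ℓ≤n))) (cancel (shift (<⇒≤ s+t<ℓ))) ⟩
          S (n ∸ t) (ℓ ∸ t)                                             ∎
          where open ≤-Reasoning
        by-size (no s+t≮ℓ) = begin
          2 * length F                   ≤⟨ *-monoʳ-≤ 2 (bounded λ Z eqZ Z! →
                                              Bounded-containing-all Z Z! (trans eqZ s+t≡ℓ)) ⟩
          2 * (ℓ ^ s * (ℓ ^ s * 1))      ≤⟨ full-branching-bound 1≤ℓ 2≤n le (subst (2 ≤_) (sym s≡ℓ∸t) 2≤ℓ∸t)
                                              (≤-trans (m≤m+n s t) s+t≤ℓ) (m∸n+n≡m ℓ≤n) ⟩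
          S (n ∸ ℓ + s) s                ≡⟨ cong₂ S (cancel n-split) s≡ℓ∸t ⟩
          S (n ∸ t) (ℓ ∸ t)              ∎
          where
          open ≤-Reasoning
          s+t≡ℓ : s + t ≡ ℓ
          s+t≡ℓ = ≤-antisym s+t≤ℓ (≮⇒≥ s+t≮ℓ)
          s≡ℓ∸t : s ≡ ℓ ∸ t
          s≡ℓ∸t = cancel s+t≡ℓ
          n-split : n ∸ ℓ + s + t ≡ n
          n-split = trans (+-assoc (n ∸ ℓ) s t) (trans (cong (n ∸ ℓ +_) s+t≡ℓ) (m∸n+n≡m ℓ≤n))

      noCover : ∀ s → NoCover s
      noCover = <-rec NoCover noCover-step

    absurd : ¬ 2 * length F ≤ S (n ∸ t) (ℓ ∸ t) → ∀ G → F ≡ G → ⊥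
    absurd ¬le [] refl = ¬le z≤n
    -- The parts of a single member form a cover of size `ℓ`, which contradicts `noCover` at
    -- `s = ℓ ∸ t`.
    absurd ¬le (P ∷ G) refl = noCover ¬le (here refl) (ℓ ∸ t) (≤-reflexive (m∸n+n≡m t≤ℓ)) (parts P)
      (trans (IsPartition.numParts (All.head isP)) (sym (m∸n+n≡m t≤ℓ))) (parts-! P)
      (All.tabulate λ {Q} Q∈ → int P Q (here refl) Q∈)
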